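{- The only solution $(m,p,q,x)$ in positive integers, with $p$ and $q$ odd primes, of the equation $$x^2+q^{2m}=2\cdot 17^p$$ is $(m,p,q,x)=(1,3,5,99)$. -}

module Defs where

open import Data.Nat using (ℕ; _+_; _*_; _^_; NonZero)
open import Data.Nat.Divisibility using (_∤_)
open import Data.Nat.Primality using (Prime)
open import Data.Product using (_×_)
open import Relation.Binary.PropositionalEquality using (_≡_)

OddPrime : ℕ → Set
OddPrime p = Prime p × 2 ∤ p

record IsSolution (m p q x : ℕ) : Set where
  field
    m-positive : NonZero m
    x-positive : NonZero x
    p-oddPrime : OddPrime p
    q-oddPrime : OddPrime q
    equation   : x ^ 2 + q ^ (2 * m) ≡ 2 * 17 ^ p

{-# OPTIONS --safe #-}
-- In ℤ[i], unique factorisation turns X² + Y² = 2·17ⁿ with 17 ∤ X into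
-- X ± iY = u(1+i)(4+i)ⁿ with u a unit.  For odd n the real and the imaginary part
-- of (1+i)(4+i)ⁿ are each divisible by 3 or by 5; dividing X and Y by powers of 17,
-- the same holds for X without the assumption 17 ∤ X, hence q ∈ {3, 5}.  So q^m is,
-- up to sign, one of the two parts of (1+i)(4+i)^p.  By periodicity modulo 9 and 25,
-- m ≥ 2 would force p = 3 or p = 5, respectively, where the parts are explicit
-- numbers.  For m = 1, periodicity modulo 80 leaves only the values that the parts
-- take at p = 1 and p = 3, and these are not taken again: (4+i)⁴ = 1 + 16(10+15i), so
-- (4+i)^(4k) is 1 + 16N(even + odd·i) with N ≠ 0 for every k ≥ 1.
module Submission where

open import Data.Empty using (⊥)
open import Data.Integer using (ℤ; +_; -[1+_]; _+_; _*_; _-_; -_; _^_; 0ℤ) renaming (∣_∣ to abs)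
open import Data.Integer.Divisibility.Signed using (_∣_; _∣?_; divides; ∣ᵤ⇒∣; ∣⇒∣ᵤ; ∣-trans; ∣m⇒∣m*n; ∣n⇒∣m*n; ∣m∣n⇒∣m+n; ∣m∣n⇒∣m-n; ∣m+n∣m⇒∣n)
open import Data.Integer.Properties using (∣-i∣≡∣i∣; abs-*; pos-*; pos-+; *-cancelˡ-≡; i*j≡0⇒i≡0∨j≡0; i≡j⇒i-j≡0; +-identityʳ; +-injective)
open import Data.Integer.Tactic.RingSolver using (solve-∀)
open import Data.Nat as ℕ using (ℕ; zero; suc)
open import Data.Nat.Divisibility as ℕ∣ using (_∤_)
open import Data.Nat.DivMod using (_%_; _/_; m≡m%n+[m/n]*n; m%n<n)
open import Data.Nat.Induction using (<-rec)
import Data.Nat.Properties as ℕ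
open import Data.Nat.Primality using (Prime; prime?; prime⇒irreducible; ¬prime[1]; euclidsLemma)
open import Data.Product using (_×_; _,_; ∃; proj₁; proj₂)
open import Data.Sum as ⊎ using (_⊎_; inj₁; inj₂; [_,_]′)
open import Data.Unit using (⊤; tt)
open import Function using (_∘_; id)
open import Function.Bundles using (_⇔_; mk⇔)
open import Relation.Binary.PropositionalEquality using (_≡_; _≢_; refl; sym; trans; cong; cong₂; subst; module ≡-Reasoning)
open import Relation.Nullary using (¬_; Dec; yes; no; contradiction)
open import Relation.Nullary.Decidable using (toWitness; from-yes; from-no; _⊎-dec_; _×-dec_; _→-dec_)
open import Defs

open ≡-Reasoning

-- Gaussian integers

infixl 7 _⊗_

record ℤ[i] : Set where
  constructor ⟨_,_⟩
  field
    re im : ℤ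

open ℤ[i]

_⊗_ : ℤ[i] → ℤ[i] → ℤ[i]
z ⊗ w = ⟨ re z * re w - im z * im w , re z * im w + im z * re w ⟩

⊗-assoc : ∀ x y z → (x ⊗ y) ⊗ z ≡ x ⊗ (y ⊗ z)
⊗-assoc ⟨ a , b ⟩ ⟨ c , d ⟩ ⟨ e , f ⟩ =
  cong₂ ⟨_,_⟩ (real a b c d e f) (imag a b c d e f)
  where
  real : ∀ a b c d e f → (a * c - b * d) * e - (a * d + b * c) * f
                       ≡ a * (c * e - d * f) - b * (c * f + d * e)
  real = solve-∀
  imag : ∀ a b c d e f → (a * c - b * d) * f + (a * d + b * c) * e
                       ≡ a * (c * f + d * e) + b * (c * e - d * f)
  imag = solve-∀

1ᵍ : ℤ[i]
1ᵍ = ⟨ + 1 , + 0 ⟩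

⊗-identityˡ : ∀ z → 1ᵍ ⊗ z ≡ z
⊗-identityˡ ⟨ a , b ⟩ = cong₂ ⟨_,_⟩ (real a b) (imag a b)
  where
  real : ∀ a b → + 1 * a - + 0 * b ≡ a
  real = solve-∀
  imag : ∀ a b → + 1 * b + + 0 * a ≡ b
  imag = solve-∀

pow : ℤ[i] → ℕ → ℤ[i]
pow z zero    = 1ᵍ
pow z (suc n) = z ⊗ pow z n

pow-+ : ∀ z m n → pow z (m ℕ.+ n) ≡ pow z m ⊗ pow z n
pow-+ z zero    n = sym (⊗-identityˡ (pow z n))
pow-+ z (suc m) n = begin
  z ⊗ pow z (m ℕ.+ n)       ≡⟨ cong (z ⊗_) (pow-+ z m n) ⟩
  z ⊗ (pow z m ⊗ pow z n)   ≡⟨ sym (⊗-assoc z (pow z m) (pow z n)) ⟩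
  z ⊗ pow z m ⊗ pow z n     ∎

γ : ℤ[i]
γ = ⟨ + 4 , + 1 ⟩

-- ω n = (1 + i)(4 + i)ⁿ
ω : ℕ → ℤ[i]
ω zero    = ⟨ + 1 , + 1 ⟩
ω (suc n) = γ ⊗ ω n

ω-+ : ∀ m n → ω (m ℕ.+ n) ≡ pow γ m ⊗ ω n
ω-+ zero    n = sym (⊗-identityˡ (ω n))
ω-+ (suc m) n = trans (cong (γ ⊗_) (ω-+ m n)) (sym (⊗-assoc γ (pow γ m) (ω n)))

shift : ∀ r s T → r ℕ.+ (T ℕ.+ s) ≡ T ℕ.+ (r ℕ.+ s)
shift r s T = begin
  r ℕ.+ (T ℕ.+ s)   ≡⟨ sym (ℕ.+-assoc r T s) ⟩
  r ℕ.+ T ℕ.+ s     ≡⟨ cong (ℕ._+ s) (ℕ.+-comm r T) ⟩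
  T ℕ.+ r ℕ.+ s     ≡⟨ ℕ.+-assoc T r s ⟩
  T ℕ.+ (r ℕ.+ s)   ∎

-- The factor is kept as a power of `pow γ T`, so that for `T = 4` facts about `pow β k` apply to
-- it.
ω-shift : ∀ r k T → ω (r ℕ.+ k ℕ.* T) ≡ pow (pow γ T) k ⊗ ω r
ω-shift r zero    T = trans (cong ω (ℕ.+-identityʳ r)) (sym (⊗-identityˡ (ω r)))
ω-shift r (suc k) T = begin
  ω (r ℕ.+ (T ℕ.+ k ℕ.* T))                ≡⟨ cong ω (shift r (k ℕ.* T) T) ⟩
  ω (T ℕ.+ (r ℕ.+ k ℕ.* T))                ≡⟨ ω-+ T (r ℕ.+ k ℕ.* T) ⟩
  pow γ T ⊗ ω (r ℕ.+ k ℕ.* T)              ≡⟨ cong (pow γ T ⊗_) (ω-shift r k T) ⟩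
  pow γ T ⊗ (pow (pow γ T) k ⊗ ω r)        ≡⟨ sym (⊗-assoc (pow γ T) (pow (pow γ T) k) (ω r)) ⟩
  pow γ T ⊗ pow (pow γ T) k ⊗ ω r          ∎

-- Periodicity of ω modulo M

infix 4 _≡_mod_

_≡_mod_ : ℤ[i] → ℤ[i] → ℤ → Set
z ≡ w mod M = M ∣ re z - re w × M ∣ im z - im w

mod-refl : ∀ {M} z → z ≡ z mod M
mod-refl {M} ⟨ a , b ⟩ = divides 0ℤ (zeroDiff a M) , divides 0ℤ (zeroDiff b M)
  where
  zeroDiff : ∀ a M → a - a ≡ + 0 * M
  zeroDiff = solve-∀

mod-trans : ∀ {M} x y z → x ≡ y mod M → y ≡ z mod M → x ≡ z mod M
mod-trans {M} x y z (p , q) (p′ , q′) =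
  subst (M ∣_) (telescope (re x) (re y) (re z)) (∣m∣n⇒∣m+n p p′) ,
  subst (M ∣_) (telescope (im x) (im y) (im z)) (∣m∣n⇒∣m+n q q′)
  where
  telescope : ∀ a b c → (a - b) + (b - c) ≡ a - c
  telescope = solve-∀

-- The difference of the two sides is (u - 1)z, whose parts are combinations of the parts of u - 1.
mod-scale : ∀ {M} u z → u ≡ 1ᵍ mod M → u ⊗ z ≡ z mod M
mod-scale {M} ⟨ c , d ⟩ ⟨ a , b ⟩ (p , q) =
  subst (M ∣_) (real a b c d) (∣m∣n⇒∣m-n (∣m⇒∣m*n a p) (∣m⇒∣m*n b q)) ,
  subst (M ∣_) (imag a b c d) (∣m∣n⇒∣m+n (∣m⇒∣m*n b p) (∣m⇒∣m*n a q))
  where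
  real : ∀ a b c d → (c - + 1) * a - (d - + 0) * b ≡ (c * a - d * b) - a
  real = solve-∀
  imag : ∀ a b c d → (c - + 1) * b + (d - + 0) * a ≡ (c * b + d * a) - b
  imag = solve-∀

ω-periodic : ∀ {M} T → pow γ T ≡ 1ᵍ mod M → ∀ r k → ω (r ℕ.+ k ℕ.* T) ≡ ω r mod M
ω-periodic {M} T period r zero =
  subst (λ n → ω n ≡ ω r mod M) (sym (ℕ.+-identityʳ r)) (mod-refl (ω r))
ω-periodic {M} T period r (suc k) =
  mod-trans (ω (r ℕ.+ suc k ℕ.* T)) (ω (r ℕ.+ k ℕ.* T)) (ω r)
    (subst (λ z → z ≡ ω (r ℕ.+ k ℕ.* T) mod M)
           (sym (trans (cong ω (shift r (k ℕ.* T) T)) (ω-+ T (r ℕ.+ k ℕ.* T))))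
           (mod-scale (pow γ T) (ω (r ℕ.+ k ℕ.* T)) period))
    (ω-periodic T period r k)

ω-reduce : ∀ {M} T .{{_ : ℕ.NonZero T}} → pow γ T ≡ 1ᵍ mod M → ∀ n → ω n ≡ ω (n % T) mod M
ω-reduce {M} T period n =
  subst (λ k → ω k ≡ ω (n % T) mod M) (sym (m≡m%n+[m/n]*n n T)) (ω-periodic T period (n % T) (n / T))

-- Divisibility by 3, 5, 9 and 25 read off from residues

∣-diffʳ : ∀ {d} a b → d ∣ a - b → d ∣ b → d ∣ a
∣-diffʳ {d} a b d∣a-b d∣b = subst (d ∣_) (cancel a b) (∣m∣n⇒∣m+n d∣a-b d∣b)
  where
  cancel : ∀ a b → (a - b) + b ≡ a
  cancel = solve-∀

∣-diffˡ : ∀ {d} a b → d ∣ a - b → d ∣ a → d ∣ b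
∣-diffˡ {d} a b d∣a-b d∣a = subst (d ∣_) (cancel a b) (∣m∣n⇒∣m-n d∣a d∣a-b)
  where
  cancel : ∀ a b → a - (a - b) ≡ b
  cancel = solve-∀

_≡?_mod_ : ∀ z w M → Dec (z ≡ w mod M)
z ≡? w mod M = (M ∣? re z - re w) ×-dec (M ∣? im z - im w)

3∣or5∣ : ℤ → Set
3∣or5∣ a = + 3 ∣ a ⊎ + 5 ∣ a

3∣or5∣? : ∀ a → Dec (3∣or5∣ a)
3∣or5∣? a = (+ 3 ∣? a) ⊎-dec (+ 5 ∣? a)

3∣or5∣-cong : ∀ {a b} → + 15 ∣ a - b → 3∣or5∣ b → 3∣or5∣ a
3∣or5∣-cong {a} {b} 15∣ =
  ⊎.map (∣-diffʳ a b (∣-trans (divides (+ 5) refl) 15∣))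
        (∣-diffʳ a b (∣-trans (divides (+ 3) refl) 15∣))

-- 4 + i has order 8 modulo 3 and order 4 modulo 5, hence period 8 modulo 15. Passing to 9 and 25
-- multiplies these orders by 3 and 5, which gives 24 and 20. Modulo 80 the period is 4 because (4 +
-- i)⁴ = 161 + 240i.
γ⁸≡1 : pow γ 8 ≡ 1ᵍ mod (+ 15)
γ⁸≡1 = toWitness {a? = pow γ 8 ≡? 1ᵍ mod (+ 15)} tt

γ²⁴≡1 : pow γ 24 ≡ 1ᵍ mod (+ 9)
γ²⁴≡1 = toWitness {a? = pow γ 24 ≡? 1ᵍ mod (+ 9)} tt

γ²⁰≡1 : pow γ 20 ≡ 1ᵍ mod (+ 25)
γ²⁰≡1 = toWitness {a? = pow γ 20 ≡? 1ᵍ mod (+ 25)} tt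

γ⁴≡1 : pow γ 4 ≡ 1ᵍ mod (+ 80)
γ⁴≡1 = toWitness {a? = pow γ 4 ≡? 1ᵍ mod (+ 80)} tt

-- Modulo 15 only `n % 8` matters. At 1, 3, 5, 7 the parts are (3, 5), (5, 99), (-717, 1525),
-- (-22955, 17139).
ω-3∣or5∣ : ∀ n → 2 ∤ n → 3∣or5∣ (re (ω n)) × 3∣or5∣ (im (ω n))
-- The period 8 is even, so an even residue would make `n` even.
ω-3∣or5∣ n 2∤n = [ (λ 2∣r → contradiction (ℕ∣.∣n∣m%n⇒∣m (ℕ∣.divides 4 refl) 2∣r) 2∤n) , lift ]′
                   (residues (m%n<n n 8))
  where
  residues : ∀ {r} → r ℕ.< 8 → 2 ℕ∣.∣ r ⊎ (3∣or5∣ (re (ω r)) × 3∣or5∣ (im (ω r)))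
  residues = toWitness {a? = ℕ.allUpTo? (λ r → (2 ℕ∣.∣? r) ⊎-dec
                                 (3∣or5∣? (re (ω r)) ×-dec 3∣or5∣? (im (ω r)))) 8} tt
  red : ω n ≡ ω (n % 8) mod (+ 15)
  red = ω-reduce 8 γ⁸≡1 n
  lift : 3∣or5∣ (re (ω (n % 8))) × 3∣or5∣ (im (ω (n % 8))) → 3∣or5∣ (re (ω n)) × 3∣or5∣ (im (ω n))
  lift (r , i) = 3∣or5∣-cong (proj₁ red) r , 3∣or5∣-cong (proj₂ red) i

-- A check of the residues modulo 24 suffices: 3 divides the period, so it divides `n` as soon as it
-- divides `n % 24`.
ω-9∣ : ∀ n → + 9 ∣ re (ω n) ⊎ + 9 ∣ im (ω n) → 3 ℕ∣.∣ n
ω-9∣ n 9∣ = ℕ∣.∣n∣m%n⇒∣m (ℕ∣.divides 8 refl) (residues (m%n<n n 24)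
    (⊎.map (∣-diffˡ (re (ω n)) _ (proj₁ red)) (∣-diffˡ (im (ω n)) _ (proj₂ red)) 9∣))
  where
  residues : ∀ {r} → r ℕ.< 24 → + 9 ∣ re (ω r) ⊎ + 9 ∣ im (ω r) → 3 ℕ∣.∣ r
  residues = toWitness {a? = ℕ.allUpTo? (λ r →
    ((+ 9 ∣? re (ω r)) ⊎-dec (+ 9 ∣? im (ω r))) →-dec (3 ℕ∣.∣? r)) 24} tt
  red : ω n ≡ ω (n % 24) mod (+ 9)
  red = ω-reduce 24 γ²⁴≡1 n

ω-25∣ : ∀ n → + 25 ∣ re (ω n) ⊎ + 25 ∣ im (ω n) → 5 ℕ∣.∣ n
ω-25∣ n 25∣ = ℕ∣.∣n∣m%n⇒∣m (ℕ∣.divides 4 refl) (residues (m%n<n n 20)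
    (⊎.map (∣-diffˡ (re (ω n)) _ (proj₁ red)) (∣-diffˡ (im (ω n)) _ (proj₂ red)) 25∣))
  where
  residues : ∀ {r} → r ℕ.< 20 → + 25 ∣ re (ω r) ⊎ + 25 ∣ im (ω r) → 5 ℕ∣.∣ r
  residues = toWitness {a? = ℕ.allUpTo? (λ r →
    ((+ 25 ∣? re (ω r)) ⊎-dec (+ 25 ∣? im (ω r))) →-dec (5 ℕ∣.∣? r)) 20} tt
  red : ω n ≡ ω (n % 20) mod (+ 25)
  red = ω-reduce 20 γ²⁰≡1 n

-- Powers of γ⁴ near 1 in the 2-adic topology

-- z = 1 + 16N(2U + (2V + 1)i)
record Near (N : ℤ) (z : ℤ[i]) : Set where
  constructor near
  field
    U V    : ℤ
    re-eq  : re z ≡ + 1 + + 32 * N * U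
    im-eq  : im z ≡ + 16 * N * (+ 1 + + 2 * V)

β : ℤ[i]
β = pow γ 4

-- 161 = 1 + 32·5 and 240 = 16(1 + 2·7).
near-β : Near (+ 1) β
near-β = near (+ 5) (+ 7) refl refl

-- With w = 2U + (2V + 1)i, (1 + 16Nw)² = 1 + 32N(w + 8Nw²), and the correction 8Nw² leaves the
-- parities of both parts of w unchanged.
near-square : ∀ N {z} → Near N z → Near (+ 2 * N) (z ⊗ z)
near-square N (near U V refl refl) =
  near (U + + 4 * N * (+ 4 * U * U - (+ 1 + + 2 * V) * (+ 1 + + 2 * V)))
       (V + + 16 * N * U * (+ 1 + + 2 * V))
       (real N U V) (imag N U V)
  where
  real : ∀ N U V →
    (+ 1 + + 32 * N * U) * (+ 1 + + 32 * N * U)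
      - (+ 16 * N * (+ 1 + + 2 * V)) * (+ 16 * N * (+ 1 + + 2 * V))
    ≡ + 1 + + 32 * (+ 2 * N) * (U + + 4 * N * (+ 4 * U * U - (+ 1 + + 2 * V) * (+ 1 + + 2 * V)))
  real = solve-∀
  imag : ∀ N U V →
    (+ 1 + + 32 * N * U) * (+ 16 * N * (+ 1 + + 2 * V))
      + (+ 16 * N * (+ 1 + + 2 * V)) * (+ 1 + + 32 * N * U)
    ≡ + 16 * (+ 2 * N) * (+ 1 + + 2 * (V + + 16 * N * U * (+ 1 + + 2 * V)))
  imag = solve-∀

-- For z = 1 + 32Nw, βz = 1 + 16(10 + 15i + 2Nβw), and both parts of 2Nβw are even. The scale drops
-- back to 1.
near-β⊗ : ∀ N {z} → Near (+ 2 * N) z → Near (+ 1) (β ⊗ z)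
near-β⊗ N (near U V refl refl) =
  near (+ 5 + + 322 * N * U - + 240 * N * (+ 1 + + 2 * V))
       (+ 7 + + 480 * N * U + + 161 * N * (+ 1 + + 2 * V))
       (real N U V) (imag N U V)
  where
  real : ∀ N U V →
    + 161 * (+ 1 + + 32 * (+ 2 * N) * U) - + 240 * (+ 16 * (+ 2 * N) * (+ 1 + + 2 * V))
    ≡ + 1 + + 32 * + 1 * (+ 5 + + 322 * N * U - + 240 * N * (+ 1 + + 2 * V))
  real = solve-∀
  imag : ∀ N U V →
    + 161 * (+ 16 * (+ 2 * N) * (+ 1 + + 2 * V)) + + 240 * (+ 1 + + 32 * (+ 2 * N) * U)
    ≡ + 16 * + 1 * (+ 1 + + 2 * (+ 7 + + 480 * N * U + + 161 * N * (+ 1 + + 2 * V)))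
  imag = solve-∀

halve : ∀ k → ∃ λ j → k ≡ j ℕ.+ j ⊎ k ≡ suc (j ℕ.+ j)
halve zero = 0 , inj₁ refl
halve (suc k) with halve k
... | j , inj₁ eq = j , inj₂ (cong suc eq)
... | j , inj₂ eq = suc j , inj₁ (cong suc (trans eq (sym (ℕ.+-suc j j))))

NearPower : ℕ → Set
NearPower k = ∃ λ N → N ≢ 0ℤ × Near N (pow β k)

near-power-even : ∀ j → NearPower j → NearPower (j ℕ.+ j)
near-power-even j (N , N≢0 , nr) =
  + 2 * N ,
  (λ 2N≡0 → [ (λ ()) , N≢0 ]′ (i*j≡0⇒i≡0∨j≡0 (+ 2) 2N≡0)) ,
  subst (Near (+ 2 * N)) (sym (pow-+ β j j)) (near-square N nr)

near-power-odd : ∀ j → NearPower j → NearPower (suc (j ℕ.+ j))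
near-power-odd j (N , _ , nr) =
  + 1 , (λ ()) , near-β⊗ N (subst (Near (+ 2 * N)) (sym (pow-+ β j j)) (near-square N nr))

-- Binary recursion: squaring for k = 2j, one more factor `β` for k = 2j + 1. The `N` obtained is
-- the largest power of 2 dividing `k`.
near-power : ∀ k → k ≢ 0 → NearPower k
near-power = <-rec (λ k → k ≢ 0 → NearPower k) (λ k rec k≢0 → step k rec k≢0 (halve k))
  where
  step : ∀ k → (∀ {j} → j ℕ.< k → j ≢ 0 → NearPower j) → k ≢ 0 →
         (∃ λ j → k ≡ j ℕ.+ j ⊎ k ≡ suc (j ℕ.+ j)) → NearPower k
  step _ rec k≢0 (zero  , inj₁ refl) = contradiction refl k≢0
  -- The recursion must stop at k = 1: `pow β 0` is 1, which admits only N = 0.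
  step _ rec k≢0 (zero  , inj₂ refl) = + 1 , (λ ()) , near-β
  step _ rec k≢0 (suc j , inj₁ refl) =
    near-power-even (suc j) (rec (ℕ.m<m+n (suc j) (ℕ.s≤s ℕ.z≤n)) (λ ()))
  step _ rec k≢0 (suc j , inj₂ refl) =
    near-power-odd (suc j) (rec (ℕ.s≤s (ℕ.m≤m+n (suc j) (suc j))) (λ ()))

private
  cancel-16N : ∀ {N t} → N ≢ 0ℤ → N * (+ 16 * t) ≡ 0ℤ → t ≡ 0ℤ
  cancel-16N {N} N≢0 eq =
    [ (λ N≡0 → contradiction N≡0 N≢0) , ([ (λ ()) , id ]′ ∘ i*j≡0⇒i≡0∨j≡0 (+ 16)) ]′
      (i*j≡0⇒i≡0∨j≡0 N eq)

-- Subtracting re w leaves 16N(2Ux - (2V + 1)y) = 0. As N ≠ 0, (2V + 1)y = 2Ux, so y is even.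
near-fixes-re : ∀ {N z} w → N ≢ 0ℤ → Near N z → re (z ⊗ w) ≡ re w → + 2 ∣ im w
near-fixes-re {N} ⟨ x , y ⟩ N≢0 (near U V refl refl) eq =
  divides (U * x - V * y) (begin
    y                                        ≡⟨ half U V x y ⟩
    (U * x - V * y) * + 2 - t                ≡⟨ cong (λ c → (U * x - V * y) * + 2 - c) t≡0 ⟩
    (U * x - V * y) * + 2 - + 0              ≡⟨ +-identityʳ _ ⟩
    (U * x - V * y) * + 2                    ∎)
  where
  t = + 2 * U * x - (+ 1 + + 2 * V) * y
  difference : ∀ N U V x y → N * (+ 16 * (+ 2 * U * x - (+ 1 + + 2 * V) * y))
    ≡ (+ 1 + + 32 * N * U) * x - (+ 16 * N * (+ 1 + + 2 * V)) * y - x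
  difference = solve-∀
  half : ∀ U V x y → y ≡ (U * x - V * y) * + 2 - (+ 2 * U * x - (+ 1 + + 2 * V) * y)
  half = solve-∀
  t≡0 : t ≡ 0ℤ
  t≡0 = cancel-16N N≢0 (trans (difference N U V x y) (i≡j⇒i-j≡0 eq))

-- Here cancelling 16N leaves 2Uy + (2V + 1)x = 0, so x is even.
near-fixes-im : ∀ {N z} w → N ≢ 0ℤ → Near N z → im (z ⊗ w) ≡ im w → + 2 ∣ re w
near-fixes-im {N} ⟨ x , y ⟩ N≢0 (near U V refl refl) eq =
  divides (- (U * y + V * x)) (begin
    x                                        ≡⟨ half U V x y ⟩
    - (U * y + V * x) * + 2 + t              ≡⟨ cong (λ c → - (U * y + V * x) * + 2 + c) t≡0 ⟩
    - (U * y + V * x) * + 2 + + 0            ≡⟨ +-identityʳ _ ⟩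
    - (U * y + V * x) * + 2                  ∎)
  where
  t = + 2 * U * y + (+ 1 + + 2 * V) * x
  difference : ∀ N U V x y → N * (+ 16 * (+ 2 * U * y + (+ 1 + + 2 * V) * x))
    ≡ (+ 1 + + 32 * N * U) * y + (+ 16 * N * (+ 1 + + 2 * V)) * x - y
  difference = solve-∀
  half : ∀ U V x y → x ≡ - (U * y + V * x) * + 2 + (+ 2 * U * y + (+ 1 + + 2 * V) * x)
  half = solve-∀
  t≡0 : t ≡ 0ℤ
  t≡0 = cancel-16N N≢0 (trans (difference N U V x y) (i≡j⇒i-j≡0 eq))

-- For k ≠ 0, multiplication by (4 + i)^(4k) would fix the real part of `ω r`, which forces the
-- imaginary part to be even.
ω-returns-re : ∀ r k → ¬ + 2 ∣ im (ω r) → re (ω (r ℕ.+ k ℕ.* 4)) ≡ re (ω r) → k ≡ 0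
ω-returns-re r zero      _   _  = refl
ω-returns-re r k@(suc _) odd eq = contradiction (even (near-power k (λ ()))) odd
  where
  even : NearPower k → + 2 ∣ im (ω r)
  even (N , N≢0 , nr) = near-fixes-re (ω r) N≢0 nr (trans (cong re (sym (ω-shift r k 4))) eq)

ω-returns-im : ∀ r k → ¬ + 2 ∣ re (ω r) → im (ω (r ℕ.+ k ℕ.* 4)) ≡ im (ω r) → k ≡ 0
ω-returns-im r zero      _   _  = refl
ω-returns-im r k@(suc _) odd eq = contradiction (even (near-power k (λ ()))) odd
  where
  even : NearPower k → + 2 ∣ re (ω r)
  even (N , N≢0 , nr) = near-fixes-im (ω r) N≢0 nr (trans (cong im (sym (ω-shift r k 4))) eq)

-- Factorisation of the solutions of X² + Y² = 2·17ⁿ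

NormEq : ℕ → ℤ → ℤ → Set
NormEq n X Y = X * X + Y * Y ≡ + 2 * (+ 17) ^ n

prime-17 : Prime 17
prime-17 = from-yes (prime? 17)

euclid-17 : ∀ a b → + 17 ∣ a * b → + 17 ∣ a ⊎ + 17 ∣ b
euclid-17 a b 17∣ab = ⊎.map ∣ᵤ⇒∣ ∣ᵤ⇒∣
  (euclidsLemma (abs a) (abs b) prime-17 (subst (17 ℕ∣.∣_) (abs-* a b) (∣⇒∣ᵤ 17∣ab)))

17∣norm : ∀ n X Y → NormEq (suc n) X Y → + 17 ∣ X * X + Y * Y
17∣norm n X Y eq = divides (+ 2 * (+ 17) ^ n) (trans eq (regroup ((+ 17) ^ n)))
  where
  regroup : ∀ P → + 2 * (+ 17 * P) ≡ + 2 * P * + 17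
  regroup = solve-∀

data Unit : ℤ[i] → Set where
  one       : Unit ⟨ + 1 , + 0 ⟩
  minus-one : Unit ⟨ - + 1 , + 0 ⟩
  i         : Unit ⟨ + 0 , + 1 ⟩
  minus-i   : Unit ⟨ + 0 , - + 1 ⟩

-- Equality up to a unit and complex conjugation.
SameParts : ℤ[i] → ℤ[i] → Set
SameParts z w = (abs (re z) ≡ abs (re w) × abs (im z) ≡ abs (im w))
              ⊎ (abs (re z) ≡ abs (im w) × abs (im z) ≡ abs (re w))

unit-sameParts : ∀ z {u} → Unit u → SameParts (z ⊗ u) z
unit-sameParts ⟨ a , b ⟩ one = inj₁ (cong abs (real a b) , cong abs (imag a b))
  where
  real : ∀ a b → a * + 1 - b * + 0 ≡ a
  real = solve-∀
  imag : ∀ a b → a * + 0 + b * + 1 ≡ b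
  imag = solve-∀
unit-sameParts ⟨ a , b ⟩ minus-one =
  inj₁ (trans (cong abs (real a b)) (∣-i∣≡∣i∣ a) , trans (cong abs (imag a b)) (∣-i∣≡∣i∣ b))
  where
  real : ∀ a b → a * - + 1 - b * + 0 ≡ - a
  real = solve-∀
  imag : ∀ a b → a * + 0 + b * - + 1 ≡ - b
  imag = solve-∀
unit-sameParts ⟨ a , b ⟩ i =
  inj₂ (trans (cong abs (real a b)) (∣-i∣≡∣i∣ b) , cong abs (imag a b))
  where
  real : ∀ a b → a * + 0 - b * + 1 ≡ - b
  real = solve-∀
  imag : ∀ a b → a * + 1 + b * + 0 ≡ a
  imag = solve-∀
unit-sameParts ⟨ a , b ⟩ minus-i =
  inj₂ (cong abs (real a b) , trans (cong abs (imag a b)) (∣-i∣≡∣i∣ a))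
  where
  real : ∀ a b → a * + 0 - b * - + 1 ≡ b
  real = solve-∀
  imag : ∀ a b → a * - + 1 + b * + 0 ≡ - a
  imag = solve-∀

abs-split : ∀ a {v} → abs a ≡ v → a ≡ + v ⊎ a ≡ - (+ v)
abs-split (+ n)    refl = inj₁ refl
abs-split -[1+ n ] refl = inj₂ refl

square-abs : ∀ a → a * a ≡ + (abs a ℕ.* abs a)
square-abs (+ n)    = sym (pos-* n n)
square-abs -[1+ n ] = refl

sum-of-squares-2 : ∀ x y → x ℕ.* x ℕ.+ y ℕ.* y ≡ 2 → x ≡ 1 × y ≡ 1
sum-of-squares-2 x y eq = both x y (bound x xx≤2) (bound y yy≤2) eq
  where
  xx≤2 : x ℕ.* x ℕ.≤ 2
  xx≤2 = ℕ.≤-trans (ℕ.m≤m+n (x ℕ.* x) (y ℕ.* y)) (ℕ.≤-reflexive eq)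
  yy≤2 : y ℕ.* y ℕ.≤ 2
  yy≤2 = ℕ.≤-trans (ℕ.m≤n+m (y ℕ.* y) (x ℕ.* x)) (ℕ.≤-reflexive eq)
  bound : ∀ z → z ℕ.* z ℕ.≤ 2 → z ℕ.≤ 1
  bound z zz≤2 = ℕ.≮⇒≥ λ 1<z →
    from-no (4 ℕ.≤? 2) (ℕ.≤-trans (ℕ.*-mono-≤ 1<z 1<z) zz≤2)
  both : ∀ x y → x ℕ.≤ 1 → y ℕ.≤ 1 → x ℕ.* x ℕ.+ y ℕ.* y ≡ 2 → x ≡ 1 × y ≡ 1
  both zero          zero          _ _ ()
  both zero          (suc zero)    _ _ ()
  both (suc zero)    zero          _ _ ()
  both (suc zero)    (suc zero)    _ _ _ = refl , refl
  both zero          (suc (suc _)) _ (ℕ.s≤s ()) _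
  both (suc zero)    (suc (suc _)) _ (ℕ.s≤s ()) _
  both (suc (suc _)) _             (ℕ.s≤s ()) _ _

-- For n ≥ 1 this says that 4 + i, rather than 4 - i, divides X + iY.
Oriented : ℕ → ℤ → ℤ → Set
Oriented zero    X Y = ⊤
Oriented (suc n) X Y = ¬ + 17 ∣ X × + 17 ∣ + 4 * X + Y

-- Induction on `n`: dividing by 4 + i divides the norm by 17, and the quotient is oriented again.
-- At norm 2 the four choices of signs are the four associates of 1 + i.
factor : ∀ n X Y → NormEq n X Y → Oriented n X Y → ∃ λ u → Unit u × ⟨ X , Y ⟩ ≡ ω n ⊗ u
factor zero X Y eq _ = signs (abs-split X (proj₁ ones)) (abs-split Y (proj₂ ones))
  where
  ones : abs X ≡ 1 × abs Y ≡ 1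
  ones = sum-of-squares-2 (abs X) (abs Y) (+-injective (begin
    + (abs X ℕ.* abs X ℕ.+ abs Y ℕ.* abs Y)        ≡⟨ pos-+ (abs X ℕ.* abs X) _ ⟩
    + (abs X ℕ.* abs X) + + (abs Y ℕ.* abs Y)      ≡⟨ sym (cong₂ _+_ (square-abs X) (square-abs Y)) ⟩
    X * X + Y * Y                                  ≡⟨ eq ⟩
    + 2                                            ∎))
  signs : X ≡ + 1 ⊎ X ≡ - + 1 → Y ≡ + 1 ⊎ Y ≡ - + 1 → ∃ λ u → Unit u × ⟨ X , Y ⟩ ≡ ω 0 ⊗ u
  signs (inj₁ refl) (inj₁ refl) = _ , one , refl
  signs (inj₁ refl) (inj₂ refl) = _ , minus-i , refl
  signs (inj₂ refl) (inj₁ refl) = _ , i , refl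
  signs (inj₂ refl) (inj₂ refl) = _ , minus-one , refl
factor (suc n) X Y eq (17∤X , divides X′ 4X+Y≡) =
  extend (factor n X′ Y′ eq′ (orient n eq′))
  where
  -- The real part of X + iY = (4 + i)(X′ + iY′) determines Y′ without a second division by 17.
  Y′ : ℤ
  Y′ = + 4 * X′ - X

  Y≡ : Y ≡ X′ * + 17 - + 4 * X
  Y≡ = trans (isolate X Y) (cong (_- + 4 * X) 4X+Y≡)
    where
    isolate : ∀ X Y → Y ≡ (+ 4 * X + Y) - + 4 * X
    isolate = solve-∀

  eq′ : NormEq n X′ Y′
  eq′ = *-cancelˡ-≡ (+ 17) _ _ (begin
    + 17 * (X′ * X′ + Y′ * Y′)                                        ≡⟨ norm X X′ ⟩
    X * X + (X′ * + 17 - + 4 * X) * (X′ * + 17 - + 4 * X)             ≡⟨ cong (λ t → X * X + t * t) (sym Y≡) ⟩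
    X * X + Y * Y                                                     ≡⟨ eq ⟩
    + 2 * (+ 17 * (+ 17) ^ n)                                         ≡⟨ regroup ((+ 17) ^ n) ⟩
    + 17 * (+ 2 * (+ 17) ^ n)                                         ∎)
    where
    norm : ∀ X X′ → + 17 * (X′ * X′ + (+ 4 * X′ - X) * (+ 4 * X′ - X))
                  ≡ X * X + (X′ * + 17 - + 4 * X) * (X′ * + 17 - + 4 * X)
    norm = solve-∀
    regroup : ∀ P → + 2 * (+ 17 * P) ≡ + 17 * (+ 2 * P)
    regroup = solve-∀

  -- (4X′ - Y′)(4X′ + Y′) ≡ 0 mod 17, and the first factor is X.
  orient : ∀ n → NormEq n X′ Y′ → Oriented n X′ Y′
  orient zero    _   = tt
  orient (suc n) eq″ = 17∤X′ , 17∣4X′+Y′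
    where
    product : ∀ X X′ → X′ * X′ * + 17 - (X′ * X′ + (+ 4 * X′ - X) * (+ 4 * X′ - X))
                     ≡ X * (+ 4 * X′ + (+ 4 * X′ - X))
    product = solve-∀
    17∣4X′+Y′ : + 17 ∣ + 4 * X′ + Y′
    17∣4X′+Y′ = [ (λ 17∣X → contradiction 17∣X 17∤X) , id ]′
      (euclid-17 X _ (subst (+ 17 ∣_) (product X X′)
        (∣m∣n⇒∣m-n (divides (X′ * X′) refl) (17∣norm n X′ Y′ eq″))))
    recover : ∀ X X′ → + 8 * X′ - (+ 4 * X′ + (+ 4 * X′ - X)) ≡ X
    recover = solve-∀
    17∤X′ : ¬ + 17 ∣ X′
    17∤X′ 17∣X′ = 17∤X (subst (+ 17 ∣_) (recover X X′) (∣m∣n⇒∣m-n (∣n⇒∣m*n (+ 8) 17∣X′) 17∣4X′+Y′))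

  γ-multiple : ⟨ X , Y ⟩ ≡ γ ⊗ ⟨ X′ , Y′ ⟩
  γ-multiple = cong₂ ⟨_,_⟩ (real X X′) (trans Y≡ (imag X X′))
    where
    real : ∀ X X′ → X ≡ + 4 * X′ - + 1 * (+ 4 * X′ - X)
    real = solve-∀
    imag : ∀ X X′ → X′ * + 17 - + 4 * X ≡ + 4 * (+ 4 * X′ - X) + + 1 * X′
    imag = solve-∀

  extend : (∃ λ u → Unit u × ⟨ X′ , Y′ ⟩ ≡ ω n ⊗ u) → ∃ λ u → Unit u × ⟨ X , Y ⟩ ≡ ω (suc n) ⊗ u
  extend (u , unit , split) = u , unit , (begin
    ⟨ X , Y ⟩              ≡⟨ γ-multiple ⟩
    γ ⊗ ⟨ X′ , Y′ ⟩        ≡⟨ cong (γ ⊗_) split ⟩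
    γ ⊗ (ω n ⊗ u)          ≡⟨ sym (⊗-assoc γ (ω n) u) ⟩
    ω (suc n) ⊗ u          ∎)

-- For n ≥ 1, 17 divides 17X² - (X² + Y²) = (4X + Y)(4X - Y), so Y or -Y is oriented; conjugation
-- does not affect the absolute values of the parts.
solution-parts : ∀ n X Y → NormEq n X Y → ¬ + 17 ∣ X → SameParts ⟨ X , Y ⟩ (ω n)
solution-parts n X Y eq 17∤X = [ direct Y eq , (λ o → flip (direct (- Y) (trans (negate X Y) eq) o)) ]′ (orientation n eq)
  where
  negate : ∀ X Y → X * X + - Y * - Y ≡ X * X + Y * Y
  negate = solve-∀
  direct : ∀ Y → NormEq n X Y → Oriented n X Y → SameParts ⟨ X , Y ⟩ (ω n)
  direct Y eq o with factor n X Y eq o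
  ... | u , unit , split = subst (λ z → SameParts z (ω n)) (sym split) (unit-sameParts (ω n) unit)
  flip : SameParts ⟨ X , - Y ⟩ (ω n) → SameParts ⟨ X , Y ⟩ (ω n)
  flip = subst (λ y → (abs X ≡ abs (re (ω n)) × y ≡ abs (im (ω n)))
                    ⊎ (abs X ≡ abs (im (ω n)) × y ≡ abs (re (ω n)))) (∣-i∣≡∣i∣ Y)
  orientation : ∀ n → NormEq n X Y → Oriented n X Y ⊎ Oriented n X (- Y)
  orientation zero    _  = inj₁ tt
  orientation (suc n) eq = ⊎.map (17∤X ,_) (17∤X ,_)
    (euclid-17 (+ 4 * X + Y) (+ 4 * X + - Y) (subst (+ 17 ∣_) (product X Y)
      (∣m∣n⇒∣m-n (divides (X * X) refl) (17∣norm n X Y eq))))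
    where
    product : ∀ X Y → X * X * + 17 - (X * X + Y * Y) ≡ (+ 4 * X + Y) * (+ 4 * X + - Y)
    product = solve-∀

-- Descent when 17 divides X

3∣or5∣-abs : ∀ {a b} → abs a ≡ abs b → 3∣or5∣ b → 3∣or5∣ a
3∣or5∣-abs eq = ⊎.map (λ h → ∣ᵤ⇒∣ (subst (3 ℕ∣.∣_) (sym eq) (∣⇒∣ᵤ h)))
                      (λ h → ∣ᵤ⇒∣ (subst (5 ℕ∣.∣_) (sym eq) (∣⇒∣ᵤ h)))

-- 17 then divides Y as well, so the left side contains 17². Only one 17 is cancelled, which keeps
-- the case `n = 0` available.
divide-17 : ∀ n X Y → NormEq (suc n) X Y → + 17 ∣ X →
            ∃ λ X′ → ∃ λ Y′ → X ≡ X′ * + 17 × + 17 * (X′ * X′ + Y′ * Y′) ≡ + 2 * (+ 17) ^ n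
divide-17 n X Y eq 17∣X@(divides X′ X≡) = X′ , Y′ , X≡ , *-cancelˡ-≡ (+ 17) _ _ (begin
    + 17 * (+ 17 * (X′ * X′ + Y′ * Y′))                  ≡⟨ norm X′ Y′ ⟩
    X′ * + 17 * (X′ * + 17) + Y′ * + 17 * (Y′ * + 17)    ≡⟨ sym (cong₂ (λ a b → a * a + b * b) X≡ (_∣_.equality 17∣Y)) ⟩
    X * X + Y * Y                                        ≡⟨ eq ⟩
    + 2 * (+ 17 * (+ 17) ^ n)                            ≡⟨ regroup ((+ 17) ^ n) ⟩
    + 17 * (+ 2 * (+ 17) ^ n)                            ∎)
  where
  17∣Y : + 17 ∣ Y
  17∣Y = ⊎.reduce
    (euclid-17 Y Y (∣m+n∣m⇒∣n (17∣norm n X Y eq) (∣m⇒∣m*n X 17∣X)))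
  Y′ : ℤ
  Y′ = _∣_.quotient 17∣Y
  norm : ∀ X Y → + 17 * (+ 17 * (X * X + Y * Y)) ≡ X * + 17 * (X * + 17) + Y * + 17 * (Y * + 17)
  norm = solve-∀
  regroup : ∀ P → + 2 * (+ 17 * P) ≡ + 17 * (+ 2 * P)
  regroup = solve-∀

solution-3∣or5∣ : ∀ n X Y → 2 ∤ n → NormEq n X Y → 3∣or5∣ X
solution-3∣or5∣ n X Y 2∤n eq = byCases n 2∤n eq (+ 17 ∣? X)
  where
  byCases : ∀ n → 2 ∤ n → NormEq n X Y → Dec (+ 17 ∣ X) → 3∣or5∣ X
  byCases n 2∤n eq (no 17∤X) =
    [ (λ h → 3∣or5∣-abs (proj₁ h) (proj₁ (ω-3∣or5∣ n 2∤n)))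
    , (λ h → 3∣or5∣-abs (proj₁ h) (proj₂ (ω-3∣or5∣ n 2∤n))) ]′ (solution-parts n X Y eq 17∤X)
  byCases zero          2∤n eq (yes _)    = contradiction (2 ℕ∣.∣0) 2∤n
  -- The equation left is 17(X′² + Y′²) = 2.
  byCases (suc zero)    2∤n eq (yes 17∣X) =
    let X′ , Y′ , _ , eq′ = divide-17 0 X Y eq 17∣X in
    contradiction (subst (+ 17 ∣_) eq′ (∣m⇒∣m*n (X′ * X′ + Y′ * Y′) (divides (+ 1) refl)))
                  (from-no (+ 17 ∣? + 2))
  -- The exponent falls by 2 and stays odd, and a divisor 3 or 5 of X′ passes to X = 17X′.
  byCases (suc (suc n)) 2∤n eq (yes 17∣X) =
    let X′ , Y′ , X≡ , eq′ = divide-17 (suc n) X Y eq 17∣X in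
    subst 3∣or5∣ (sym X≡) (⊎.map (∣m⇒∣m*n (+ 17)) (∣m⇒∣m*n (+ 17))
      (solution-3∣or5∣ n X′ Y′ (λ 2∣n → 2∤n (ℕ∣.∣m∣n⇒∣m+n ℕ∣.∣-refl 2∣n))
        (*-cancelˡ-≡ (+ 17) _ _ (trans eq′ (regroup ((+ 17) ^ n))))))
    where
    regroup : ∀ P → + 2 * (+ 17 * P) ≡ + 17 * (+ 2 * P)
    regroup = solve-∀

-- Small values of ω

odd-mod-4 : ∀ n → 2 ∤ n → ∃ λ k → n ≡ 1 ℕ.+ k ℕ.* 4 ⊎ n ≡ 3 ℕ.+ k ℕ.* 4
odd-mod-4 0 2∤n = contradiction (2 ℕ∣.∣0) 2∤n
odd-mod-4 1 _   = 0 , inj₁ refl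
odd-mod-4 2 2∤n = contradiction ℕ∣.∣-refl 2∤n
odd-mod-4 3 _   = 0 , inj₂ refl
odd-mod-4 (suc (suc (suc (suc n)))) 2∤n
  with odd-mod-4 n (λ 2∣n → 2∤n (ℕ∣.∣m∣n⇒∣m+n (ℕ∣.divides 2 refl) 2∣n))
... | k , inj₁ refl = suc k , inj₁ refl
... | k , inj₂ refl = suc k , inj₂ refl

-- The sign + keeps the equality, for use when `v` is the value at the residue itself; for the sign
-- - the congruence alone is refuted in every case below.
residue-split : ∀ a c {v M} → abs a ≡ v → M ∣ a - c → (a ≡ + v × M ∣ + v - c) ⊎ M ∣ - (+ v) - c
residue-split a c ∣a∣≡v M∣ with abs-split a ∣a∣≡v
... | inj₁ refl = inj₁ (refl , M∣)
... | inj₂ refl = inj₂ M∣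

re-ω-split : ∀ r k {v} → abs (re (ω (r ℕ.+ k ℕ.* 4))) ≡ v →
  (re (ω (r ℕ.+ k ℕ.* 4)) ≡ + v × + 80 ∣ + v - re (ω r)) ⊎ + 80 ∣ - (+ v) - re (ω r)
re-ω-split r k eq = residue-split (re (ω (r ℕ.+ k ℕ.* 4))) (re (ω r)) eq (proj₁ (ω-periodic 4 γ⁴≡1 r k))

im-ω-split : ∀ r k {v} → abs (im (ω (r ℕ.+ k ℕ.* 4))) ≡ v →
  (im (ω (r ℕ.+ k ℕ.* 4)) ≡ + v × + 80 ∣ + v - im (ω r)) ⊎ + 80 ∣ - (+ v) - im (ω r)
im-ω-split r k eq = residue-split (im (ω (r ℕ.+ k ℕ.* 4))) (im (ω r)) eq (proj₂ (ω-periodic 4 γ⁴≡1 r k))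

-- Modulo 80 the odd terms repeat ω 1 = 3 + 5i and ω 3 = 5 + 99i. The value 3 fits only the real
-- part for n ≡ 1 modulo 4, where it is not taken again because 5 is odd.
∣ω∣≡3 : ∀ n → 2 ∤ n → abs (re (ω n)) ≡ 3 ⊎ abs (im (ω n)) ≡ 3 → n ≡ 1
∣ω∣≡3 n 2∤n with odd-mod-4 n 2∤n
... | k , inj₁ refl = [ real , imag ]′
  where
  real : abs (re (ω (1 ℕ.+ k ℕ.* 4))) ≡ 3 → 1 ℕ.+ k ℕ.* 4 ≡ 1
  real eq with re-ω-split 1 k eq
  ... | inj₁ (re≡3 , _) = cong (λ k → 1 ℕ.+ k ℕ.* 4) (ω-returns-re 1 k (from-no (+ 2 ∣? + 5)) re≡3)
  ... | inj₂ 80∣ = contradiction 80∣ (from-no (+ 80 ∣? - (+ 3) - + 3))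
  imag : abs (im (ω (1 ℕ.+ k ℕ.* 4))) ≡ 3 → 1 ℕ.+ k ℕ.* 4 ≡ 1
  imag eq with im-ω-split 1 k eq
  ... | inj₁ (_ , 80∣) = contradiction 80∣ (from-no (+ 80 ∣? + 3 - + 5))
  ... | inj₂ 80∣ = contradiction 80∣ (from-no (+ 80 ∣? - (+ 3) - + 5))
... | k , inj₂ refl = [ real , imag ]′
  where
  real : abs (re (ω (3 ℕ.+ k ℕ.* 4))) ≡ 3 → 3 ℕ.+ k ℕ.* 4 ≡ 1
  real eq with re-ω-split 3 k eq
  ... | inj₁ (_ , 80∣) = contradiction 80∣ (from-no (+ 80 ∣? + 3 - + 5))
  ... | inj₂ 80∣ = contradiction 80∣ (from-no (+ 80 ∣? - (+ 3) - + 5))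
  imag : abs (im (ω (3 ℕ.+ k ℕ.* 4))) ≡ 3 → 3 ℕ.+ k ℕ.* 4 ≡ 1
  imag eq with im-ω-split 3 k eq
  -- 3 - 99 = -96 is a multiple of 16; the factor 5 of the modulus excludes it.
  ... | inj₁ (_ , 80∣) = contradiction 80∣ (from-no (+ 80 ∣? + 3 - + 99))
  ... | inj₂ 80∣ = contradiction 80∣ (from-no (+ 80 ∣? - (+ 3) - + 99))

-- 5 is both the imaginary part of `ω 1` and the real part of `ω 3`. Neither is taken again, since
-- the companion parts 3 and 99 are odd.
∣ω∣≡5 : ∀ n → 2 ∤ n → abs (re (ω n)) ≡ 5 ⊎ abs (im (ω n)) ≡ 5 → n ≡ 1 ⊎ n ≡ 3
∣ω∣≡5 n 2∤n with odd-mod-4 n 2∤n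
... | k , inj₁ refl = inj₁ ∘ [ real , imag ]′
  where
  real : abs (re (ω (1 ℕ.+ k ℕ.* 4))) ≡ 5 → 1 ℕ.+ k ℕ.* 4 ≡ 1
  real eq with re-ω-split 1 k eq
  ... | inj₁ (_ , 80∣) = contradiction 80∣ (from-no (+ 80 ∣? + 5 - + 3))
  ... | inj₂ 80∣ = contradiction 80∣ (from-no (+ 80 ∣? - (+ 5) - + 3))
  imag : abs (im (ω (1 ℕ.+ k ℕ.* 4))) ≡ 5 → 1 ℕ.+ k ℕ.* 4 ≡ 1
  imag eq with im-ω-split 1 k eq
  ... | inj₁ (im≡5 , _) = cong (λ k → 1 ℕ.+ k ℕ.* 4) (ω-returns-im 1 k (from-no (+ 2 ∣? + 3)) im≡5)
  ... | inj₂ 80∣ = contradiction 80∣ (from-no (+ 80 ∣? - (+ 5) - + 5))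
... | k , inj₂ refl = inj₂ ∘ [ real , imag ]′
  where
  real : abs (re (ω (3 ℕ.+ k ℕ.* 4))) ≡ 5 → 3 ℕ.+ k ℕ.* 4 ≡ 3
  real eq with re-ω-split 3 k eq
  ... | inj₁ (re≡5 , _) = cong (λ k → 3 ℕ.+ k ℕ.* 4) (ω-returns-re 3 k (from-no (+ 2 ∣? + 99)) re≡5)
  ... | inj₂ 80∣ = contradiction 80∣ (from-no (+ 80 ∣? - (+ 5) - + 5))
  imag : abs (im (ω (3 ℕ.+ k ℕ.* 4))) ≡ 5 → 3 ℕ.+ k ℕ.* 4 ≡ 3
  imag eq with im-ω-split 3 k eq
  ... | inj₁ (_ , 80∣) = contradiction 80∣ (from-no (+ 80 ∣? + 5 - + 99))
  ... | inj₂ 80∣ = contradiction 80∣ (from-no (+ 80 ∣? - (+ 5) - + 99))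

-- The equation for q = 3 and q = 5

prime-∣-prime : ∀ {r q} → Prime r → Prime q → r ℕ∣.∣ q → r ≡ q
prime-∣-prime {r} {q} prime-r prime-q r∣q with prime⇒irreducible prime-q r∣q
... | inj₁ refl = contradiction prime-r ¬prime[1]
... | inj₂ r≡q  = r≡q

prime-∣-^ : ∀ {r} q m → Prime r → r ℕ∣.∣ q ℕ.^ m → r ℕ∣.∣ q
prime-∣-^ q zero prime-r r∣1 with ℕ∣.∣1⇒≡1 r∣1
... | refl = contradiction prime-r ¬prime[1]
prime-∣-^ q (suc m) prime-r r∣ =
  [ id , prime-∣-^ q m prime-r ]′ (euclidsLemma q (q ℕ.^ m) prime-r r∣)

prime-3 : Prime 3
prime-3 = from-yes (prime? 3)

prime-5 : Prime 5
prime-5 = from-yes (prime? 5)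

prime≢1 : ∀ {p} → Prime p → p ≢ 1
prime≢1 prime-p refl = ¬prime[1] prime-p

power-parts : ∀ q m p x → 17 ∤ q → NormEq p (+ (q ℕ.^ m)) (+ x) →
  (q ℕ.^ m ≡ abs (re (ω p)) × x ≡ abs (im (ω p))) ⊎ (q ℕ.^ m ≡ abs (im (ω p)) × x ≡ abs (re (ω p)))
power-parts q m p x 17∤q eq =
  solution-parts p (+ (q ℕ.^ m)) (+ x) eq (λ 17∣ → 17∤q (prime-∣-^ q m prime-17 (∣⇒∣ᵤ 17∣)))

∣-part : ∀ {d Q a} → d ℕ∣.∣ Q → Q ≡ abs a → + d ∣ a
∣-part d∣Q Q≡ = ∣ᵤ⇒∣ (subst (_ ℕ∣.∣_) Q≡ d∣Q)

base²∣ : ∀ q m → q ℕ.* q ℕ∣.∣ q ℕ.^ suc (suc m)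
base²∣ q m = subst (q ℕ.* q ℕ∣.∣_) (ℕ.*-assoc q q (q ℕ.^ m)) (ℕ∣.m∣m*n (q ℕ.^ m))

-- 99, the imaginary part of `ω 3`, is a multiple of 9, so the test has to be made at 27.
3^m≢99 : ∀ m → 3 ℕ.^ m ≢ 99
3^m≢99 0 ()
3^m≢99 1 ()
3^m≢99 2 ()
3^m≢99 (suc (suc (suc m))) eq =
  from-no (27 ℕ∣.∣? 99) (subst (27 ℕ∣.∣_) eq (ℕ∣.*-monoʳ-∣ 3 (base²∣ 3 m)))

-- 1525 = 25·61 is the imaginary part of `ω 5`, so the test has to be made at 125.
5^m≢1525 : ∀ m → 5 ℕ.^ m ≢ 1525
5^m≢1525 0 ()
5^m≢1525 1 ()
5^m≢1525 2 ()
5^m≢1525 (suc (suc (suc m))) eq =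
  from-no (125 ℕ∣.∣? 1525) (subst (125 ℕ∣.∣_) eq (ℕ∣.*-monoʳ-∣ 5 (base²∣ 5 m)))

-- m = 1 would give p = 1. For m ≥ 2, 9 divides a part of `ω p`, so 3 divides the prime p and p = 3;
-- but neither 5 nor 99 is a power of 3.
no-solution-3 : ∀ m p x → .{{ℕ.NonZero m}} → Prime p → 2 ∤ p → ¬ NormEq p (+ (3 ℕ.^ m)) (+ x)
no-solution-3 1 p x prime-p 2∤p eq =
  prime≢1 prime-p (∣ω∣≡3 p 2∤p (⊎.map (sym ∘ proj₁) (sym ∘ proj₁) (power-parts 3 1 p x (from-no (17 ℕ∣.∣? 3)) eq)))
no-solution-3 (suc (suc m)) p x prime-p 2∤p eq = conclude p≡3 parts
  where
  parts = power-parts 3 (suc (suc m)) p x (from-no (17 ℕ∣.∣? 3)) eq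
  p≡3 : 3 ≡ p
  p≡3 = prime-∣-prime prime-3 prime-p (ω-9∣ p
    (⊎.map (∣-part (base²∣ 3 m) ∘ proj₁) (∣-part (base²∣ 3 m) ∘ proj₁) parts))
  conclude : ∀ {p} → 3 ≡ p →
    (3 ℕ.^ suc (suc m) ≡ abs (re (ω p)) × x ≡ abs (im (ω p))) ⊎
    (3 ℕ.^ suc (suc m) ≡ abs (im (ω p)) × x ≡ abs (re (ω p))) → ⊥
  conclude refl (inj₁ (3^m≡5 , _))  = from-no (9 ℕ∣.∣? 5) (subst (9 ℕ∣.∣_) 3^m≡5 (base²∣ 3 m))
  conclude refl (inj₂ (3^m≡99 , _)) = 3^m≢99 (suc (suc m)) 3^m≡99

-- m = 1 leaves p = 3, since 1 is not prime. For m ≥ 2, 25 divides a part of `ω p`, so p = 5; but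
-- neither 717 nor 1525 is a power of 5.
solution-5 : ∀ m p x → .{{ℕ.NonZero m}} → Prime p → 2 ∤ p → NormEq p (+ (5 ℕ.^ m)) (+ x) →
             m ≡ 1 × p ≡ 3 × x ≡ 99
solution-5 1 p x prime-p 2∤p eq =
  conclude (∣ω∣≡5 p 2∤p (⊎.map (sym ∘ proj₁) (sym ∘ proj₁) parts)) parts
  where
  parts = power-parts 5 1 p x (from-no (17 ℕ∣.∣? 5)) eq
  conclude : p ≡ 1 ⊎ p ≡ 3 →
    (5 ≡ abs (re (ω p)) × x ≡ abs (im (ω p))) ⊎ (5 ≡ abs (im (ω p)) × x ≡ abs (re (ω p))) →
    1 ≡ 1 × p ≡ 3 × x ≡ 99
  conclude (inj₁ p≡1)  _                   = contradiction p≡1 (prime≢1 prime-p)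
  conclude (inj₂ refl) (inj₁ (_ , x≡99))   = refl , refl , x≡99
  conclude (inj₂ refl) (inj₂ (() , _))
solution-5 (suc (suc m)) p x prime-p 2∤p eq = contradiction parts (conclude p≡5)
  where
  parts = power-parts 5 (suc (suc m)) p x (from-no (17 ℕ∣.∣? 5)) eq
  p≡5 : 5 ≡ p
  p≡5 = prime-∣-prime prime-5 prime-p (ω-25∣ p
    (⊎.map (∣-part (base²∣ 5 m) ∘ proj₁) (∣-part (base²∣ 5 m) ∘ proj₁) parts))
  conclude : ∀ {p} → 5 ≡ p → ¬ (
    (5 ℕ.^ suc (suc m) ≡ abs (re (ω p)) × x ≡ abs (im (ω p))) ⊎
    (5 ℕ.^ suc (suc m) ≡ abs (im (ω p)) × x ≡ abs (re (ω p))))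
  conclude refl (inj₁ (5^m≡717 , _))  = from-no (25 ℕ∣.∣? 717) (subst (25 ℕ∣.∣_) 5^m≡717 (base²∣ 5 m))
  conclude refl (inj₂ (5^m≡1525 , _)) = 5^m≢1525 (suc (suc m)) 5^m≡1525

-- Passage from the natural numbers to the norm equation, and conclusion

pos-^ : ∀ b n → + (b ℕ.^ n) ≡ (+ b) ^ n
pos-^ b zero    = refl
pos-^ b (suc n) = trans (pos-* b (b ℕ.^ n)) (cong (+ b *_) (pos-^ b n))

-- The summands are exchanged so that `q ^ m` stands in the place of X, the variable to which
-- divisibility by 3 or 5 applies.
normEq : ∀ m p q x → x ℕ.^ 2 ℕ.+ q ℕ.^ (2 ℕ.* m) ≡ 2 ℕ.* 17 ℕ.^ p → NormEq p (+ (q ℕ.^ m)) (+ x)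
normEq m p q x eq = begin
  + Q * + Q + + x * + x                ≡⟨ sym (cong₂ _+_ (pos-* Q Q) (pos-* x x)) ⟩
  + (Q ℕ.* Q) + + (x ℕ.* x)            ≡⟨ sym (pos-+ (Q ℕ.* Q) (x ℕ.* x)) ⟩
  + (Q ℕ.* Q ℕ.+ x ℕ.* x)              ≡⟨ cong +_ (ℕ.+-comm (Q ℕ.* Q) (x ℕ.* x)) ⟩
  + (x ℕ.* x ℕ.+ Q ℕ.* Q)              ≡⟨ cong +_ (cong₂ ℕ._+_ x² Q²) ⟩
  + (x ℕ.^ 2 ℕ.+ q ℕ.^ (2 ℕ.* m))      ≡⟨ cong +_ eq ⟩
  + (2 ℕ.* 17 ℕ.^ p)                   ≡⟨ pos-* 2 (17 ℕ.^ p) ⟩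
  + 2 * + (17 ℕ.^ p)                   ≡⟨ cong (+ 2 *_) (pos-^ 17 p) ⟩
  + 2 * (+ 17) ^ p                     ∎
  where
  Q = q ℕ.^ m
  x² : x ℕ.* x ≡ x ℕ.^ 2
  x² = cong (x ℕ.*_) (sym (ℕ.*-identityʳ x))
  Q² : Q ℕ.* Q ≡ q ℕ.^ (2 ℕ.* m)
  Q² = trans (sym (ℕ.^-distribˡ-+-* q m m)) (cong (λ k → q ℕ.^ (m ℕ.+ k)) (sym (ℕ.+-identityʳ m)))

solution-unique : ∀ {m p q x} → IsSolution m p q x → (m , p , q , x) ≡ (1 , 3 , 5 , 99)
solution-unique {m} {p} {q} {x} sol =
  conclude (⊎.map (base prime-3) (base prime-5) (solution-3∣or5∣ p (+ (q ℕ.^ m)) (+ x) 2∤p eq))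
  where
  open IsSolution sol
  instance _ = m-positive
  prime-p = proj₁ p-oddPrime
  2∤p     = proj₂ p-oddPrime
  eq : NormEq p (+ (q ℕ.^ m)) (+ x)
  eq = normEq m p q x equation
  base : ∀ {r} → Prime r → + r ∣ + (q ℕ.^ m) → q ≡ r
  base prime-r r∣ = sym (prime-∣-prime prime-r (proj₁ q-oddPrime) (prime-∣-^ q m prime-r (∣⇒∣ᵤ r∣)))
  from-5 : m ≡ 1 × p ≡ 3 × x ≡ 99 → (m , p , 5 , x) ≡ (1 , 3 , 5 , 99)
  from-5 (refl , refl , refl) = refl
  conclude : q ≡ 3 ⊎ q ≡ 5 → (m , p , q , x) ≡ (1 , 3 , 5 , 99)
  conclude (inj₁ q≡3) = contradiction
    (subst (λ q → NormEq p (+ (q ℕ.^ m)) (+ x)) q≡3 eq) (no-solution-3 m p x prime-p 2∤p)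
  conclude (inj₂ q≡5) = trans (cong (λ q → m , p , q , x) q≡5) (from-5
    (solution-5 m p x prime-p 2∤p (subst (λ q → NormEq p (+ (q ℕ.^ m)) (+ x)) q≡5 eq)))

solution-exists : IsSolution 1 3 5 99
solution-exists = record
  { m-positive = _
  ; x-positive = _
  ; p-oddPrime = prime-3 , from-no (2 ℕ∣.∣? 3)
  ; q-oddPrime = prime-5 , from-no (2 ℕ∣.∣? 5)
  -- Both sides evaluate to 9826.
  ; equation   = refl
  }

theorem3 : (m p q x : ℕ) → IsSolution m p q x ⇔ ((m , p , q , x) ≡ (1 , 3 , 5 , 99))
theorem3 m p q x = mk⇔ solution-unique λ { refl → solution-exists }
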